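{- For a partition $\lambda$ define \[ \widetilde{\mathrm{wt}}_{\mathbb{Z}_3}(\lambda)=\left|\{\square\in\lambda : a(\square)+1\equiv l(\square) \pmod 3\}\right|, \] and define nonnegative integers $\tilde b_{k,n}$ by \[ \sum_{\lambda}q^{|\lambda|}t^{\widetilde{\mathrm{wt}}_{\mathbb{Z}_3}(\lambda)}=\sum_{k,n\ge 0}\tilde b_{k,n}t^kq^n, \] the sum running over all partitions $\lambda$ (including the empty one); i.e. $\tilde b_{k,n}$ is the number of partitions $\lambda$ of $n$ with $\widetilde{\mathrm{wt}}_{\mathbb{Z}_3}(\lambda)=k$. Then for all $n\ge 2$, \[ \tilde b_{n,2n}=1,\qquad \tilde b_{n,2n+1}=3, \] and $\tilde b_{k,n}=0$ whenever $k>n/2$.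
   Context: Partitions are represented by southwest-justified Young diagrams (French convention): a partition $\lambda=(\lambda_1\ge\lambda_2\ge\cdots\ge\lambda_\ell>0)$ has $\lambda_r$ boxes in its $r$-th row from the bottom. $|\lambda|$ is the number of boxes. For a box $\square\in\lambda$, the arm $a(\square)$ is the number of boxes of $\lambda$ strictly above $\square$ in its column, and the leg $l(\square)$ is the number of boxes of $\lambda$ strictly to the right of $\square$ in its row. -}

module Defs where

open import Data.Nat using (ℕ; zero; suc; _+_; _∸_; _≥_; _>_; _<_; _≤_; _%_; _≤ᵇ_)
open import Data.Nat.Properties using (_≟_)
open import Data.List using (List; []; _∷_; length; map; upTo; concatMap; filterᵇ)
open import Data.Nat.ListAction using (sum)
open import Data.List.Relation.Unary.All using (All)
open import Data.List.Relation.Unary.Linked using (Linked)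
open import Data.List.Relation.Unary.Unique.Propositional using (Unique)
open import Data.List.Membership.Propositional using (_∈_)
open import Data.Bool using (Bool; true; false; if_then_else_)
open import Data.Product using (Σ; _×_; _,_)
open import Relation.Nullary using (yes; no)
open import Relation.Binary.PropositionalEquality using (_≡_)

-- A partition is a list of its parts λ₁ ≥ λ₂ ≥ ⋯ ≥ λ_ℓ > 0
-- (λ_r = number of boxes in the r-th row from the bottom).
IsPartition : List ℕ → Set
IsPartition λ′ = Linked _≥_ λ′ × All (λ x → x > 0) λ′

size : List ℕ → ℕ
size = sum

IsPartitionOf : ℕ → List ℕ → Set
IsPartitionOf n λ′ = IsPartition λ′ × size λ′ ≡ n

part : List ℕ → ℕ → ℕ
part []       _       = 0
part (x ∷ _)  zero    = x
part (_ ∷ xs) (suc i) = part xs i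

colHeight : List ℕ → ℕ → ℕ
colHeight []       _ = 0
colHeight (x ∷ xs) j = (if suc j ≤ᵇ x then 1 else 0) + colHeight xs j

-- Boxes are pairs (i , j) with i < ℓ(λ), j < λ_{i+1}  (0-indexed row, column).
-- arm: number of boxes strictly above (i , j) in its column
arm : List ℕ → ℕ → ℕ → ℕ
arm λ′ i j = colHeight λ′ j ∸ suc i

-- leg: number of boxes strictly to the right of (i , j) in its row
leg : List ℕ → ℕ → ℕ → ℕ
leg λ′ i j = part λ′ i ∸ suc j

boxes : List ℕ → List (ℕ × ℕ)
boxes λ′ = concatMap (λ i → map (λ j → i , j) (upTo (part λ′ i))) (upTo (length λ′))

cond : List ℕ → ℕ × ℕ → Bool
cond λ′ (i , j) with (arm λ′ i j + 1) % 3 ≟ leg λ′ i j % 3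
... | yes _ = true
... | no  _ = false

wtZ3 : List ℕ → ℕ
wtZ3 λ′ = length (filterᵇ (cond λ′) (boxes λ′))

HasCount : {A : Set} → (A → Set) → ℕ → Set
HasCount {A} P c = Σ (List A) λ xs →
  length xs ≡ c × Unique xs × (∀ x → P x → x ∈ xs) × All P xs

btilde≡ : ℕ → ℕ → ℕ → Set
btilde≡ k n c = HasCount (λ λ′ → IsPartitionOf n λ′ × wtZ3 λ′ ≡ k) c

{-# OPTIONS --safe #-}

-- Read the boundary of λ from its top left end as a word in H (step right) and V (step down), and give
-- each letter the class mod 3 of the height #V - #H reached after it.  A box is a pair of an H and a later V,
-- and it is counted by the weight exactly when the two letters have the same class.  If k is the number of
-- H's of one class minus the number of the other H's, then |λ| - 2 wt is at least a triangular number of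
-- about k, by induction along the word; in particular it is nonnegative.  A word with |λ| - 2 wt ≤ 1 meets
-- this bound almost tightly in every prefix, which forces (HV)ᵃ H (HV)ᵇ H (HV)ᶜ, up to inserting HHH before the
-- last V or VVV after the first H, each at the cost of 1.  For (HV)ᵃ H (HV)ᵇ H (HV)ᶜ the difference is the triangular
-- number of a + c - b, which pins down b up to two choices, and then the weight determines a and c.

module Submission where

open import Defs
open import Data.Bool using (Bool; true; false; if_then_else_)
open import Data.Bool.Properties using (T-≡)
open import Data.Nat using (ℕ; zero; suc; _+_; _*_; _∸_; _%_; _≤_; _<_; _≥_; _>_; _≤ᵇ_; z≤n; s≤s)
open import Data.Nat.DivMod using (%-distribˡ-+)
open import Data.Nat.ListAction using (sum)
open import Data.Nat.Properties
open import Data.Nat.Tactic.RingSolver using (solve-∀)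
open import Data.List using (List; []; _∷_; _++_; length; map; concatMap; filterᵇ; applyUpTo)
open import Data.List.Membership.Propositional using (_∈_)
open import Data.List.Properties using (length-++; filter-++)
open import Data.List.Relation.Unary.All as All using (All; []; _∷_)
open import Data.List.Relation.Unary.AllPairs using ([]; _∷_)
open import Data.List.Relation.Unary.Any using (here; there)
open import Data.List.Relation.Unary.Linked as Linked using (Linked; []; [-]; _∷_)
open import Data.Product using (∃; _×_; _,_; proj₁; proj₂)
open import Data.Sum using (_⊎_; inj₁; inj₂)
open import Function using (_∘_; id)
open import Function.Bundles using (mk⇔; Equivalence)
open import Relation.Nullary using (yes; no; does; contradiction)
open import Relation.Nullary.Decidable using (does-⇔; dec-true; dec-false; T?)
open import Relation.Binary.PropositionalEquality

-- Triangular numbers.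

T : ℕ → ℕ
T zero    = 0
T (suc k) = suc k + T k

T-+ : ∀ p q → T (p + q) ≡ T p + T q + p * q
T-+ zero    q = sym (+-identityʳ (T q))
T-+ (suc p) q rewrite T-+ p q = lemma p q (T p) (T q)
  where
  lemma : ∀ p q s t → suc (p + q) + (s + t + p * q) ≡ suc p + s + t + suc p * q
  lemma = solve-∀

T+T : ∀ k → T k + T k ≡ k * k + k
T+T zero    = refl
T+T (suc k) = trans (lemma₁ k (T k)) (trans (cong (2 * suc k +_) (T+T k)) (lemma₂ k))
  where
  lemma₁ : ∀ k t → suc k + t + (suc k + t) ≡ 2 * suc k + (t + t)
  lemma₁ = solve-∀
  lemma₂ : ∀ k → 2 * suc k + (k * k + k) ≡ suc k * suc k + suc k
  lemma₂ = solve-∀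

-- T extends to a polynomial that is nonnegative on ℤ, and this is T (p - q - 1) ≥ 0.
product≤T+T : ∀ p q → p * q + p ≤ T p + T q
product≤T+T zero    q       = z≤n
product≤T+T (suc p) zero    rewrite *-zeroʳ p = ≤-trans (m≤m+n (suc p) (T p)) (m≤m+n _ 0)
product≤T+T (suc p) (suc q) = subst₂ _≤_ (lemma₁ p q) (lemma₂ p q (T p) (T q))
                                (+-monoʳ-≤ (p + q + 2) (product≤T+T p q))
  where
  lemma₁ : ∀ p q → p + q + 2 + (p * q + p) ≡ suc p * suc q + suc p
  lemma₁ = solve-∀
  lemma₂ : ∀ p q s t → p + q + 2 + (s + t) ≡ suc p + s + (suc q + t)
  lemma₂ = solve-∀

-- The equation says B - A = (y - x) + s.
≤-by : ∀ {x y A B} s → x ≤ y → A + s + y ≡ B + x → A ≤ B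
≤-by {x} {y} {A} {B} s x≤y eq =
  ≤-trans (m≤m+n A s) (+-cancelʳ-≤ y (A + s) B (≤-trans (≤-reflexive eq) (+-monoʳ-≤ B x≤y)))

-- Lower bounds on n - 2 N and their behaviour under H and V.

-- These are the tangents of n - 2 N ≥ T (k - 1) + σ for k = u - v - w, and of n - 2 N ≥ T k + σ for k = v - u - w and
-- for k = w - u - v, one for each j; unlike the quadratic bounds they need no case distinction on the sign of k.
record Bounded (σ u v w n N : ℕ) : Set where
  constructor bounds
  field
    bound₀ : ∀ j → σ + j * u + 2 * N ≤ n + j * (v + w) + T j
    bound₁ : ∀ j → σ + suc j * v + 2 * N ≤ n + suc j * (u + w) + T j
    bound₂ : ∀ j → σ + suc j * w + 2 * N ≤ n + suc j * (u + v) + T j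

open Bounded

-- Put k₀ = u - v - w, k₁ = v - u - w, k₂ = w - u - v. The letter H leaves n - 2 N alone and turns
-- (k₀, k₁, k₂) into (k₂ + 1, k₀ - 1, k₁ - 1), so each new tangent is an old one, at a neighbouring
-- slope where needed, plus slack.
Bounded-H : ∀ {σ u v w n N} → Bounded σ u v w n N → Bounded σ (suc w) u v n N
Bounded-H {σ} {u} {v} {w} {n} {N} B = bounds b₀ b₁ b₂
  where
  e₀ : ∀ σ u v w n N j t → σ + suc j * suc w + 2 * N + 0 + (n + suc j * (u + v) + t)
                         ≡ n + suc j * (u + v) + (suc j + t) + (σ + suc j * w + 2 * N)
  e₀ = solve-∀
  e₁ : ∀ σ u v w n N j t → σ + suc j * u + 2 * N + 0 + (n + suc j * (v + w) + (suc j + t))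
                         ≡ n + suc j * (suc w + v) + t + (σ + suc j * u + 2 * N)
  e₁ = solve-∀
  e₂ : ∀ σ u v w n N j t → σ + suc j * v + 2 * N + suc j + (n + suc j * (u + w) + t)
                         ≡ n + suc j * (suc w + u) + t + (σ + suc j * v + 2 * N)
  e₂ = solve-∀
  b₀ : ∀ j → σ + j * suc w + 2 * N ≤ n + j * (u + v) + T j
  b₀ zero    = bound₀ B 0
  b₀ (suc j) = ≤-by 0 (bound₂ B j) (e₀ σ u v w n N j (T j))
  b₁ : ∀ j → σ + suc j * u + 2 * N ≤ n + suc j * (suc w + v) + T j
  b₁ j = ≤-by 0 (bound₀ B (suc j)) (e₁ σ u v w n N j (T j))
  b₂ : ∀ j → σ + suc j * v + 2 * N ≤ n + suc j * (suc w + u) + T j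
  b₂ j = ≤-by (suc j) (bound₁ B j) (e₂ σ u v w n N j (T j))

-- The letter V turns (k₀, k₁, k₂) into (k₁, k₂, k₀) and adds u + w - v = -k₁ to n - 2 N. For the
-- first bound this is exact: T k₁ - k₁ = T (k₁ - 1).
Bounded-V : ∀ {σ u v w n N} → Bounded σ u v w n N → Bounded σ v w u (u + v + w + n) (v + N)
Bounded-V {σ} {u} {v} {w} {n} {N} B = bounds b₀ b₁ b₂
  where
  e₀ : ∀ σ u v w n N j t → σ + j * v + 2 * (v + N) + 0 + (n + suc j * (u + w) + t)
                         ≡ u + v + w + n + j * (w + u) + t + (σ + suc j * v + 2 * N)
  e₀ = solve-∀
  e₁ : ∀ σ u v w n N → σ + 1 * w + 2 * (v + N) + (u + u) + (n + 0 + 0)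
                     ≡ u + v + w + n + 1 * (v + u) + 0 + (σ + 0 + 2 * N)
  e₁ = solve-∀
  e₁′ : ∀ σ u v w n N j t → σ + suc (suc j) * w + 2 * (v + N) + (u + u + suc j) + (n + suc j * (u + v) + t)
                         ≡ u + v + w + n + suc (suc j) * (v + u) + (suc j + t) + (σ + suc j * w + 2 * N)
  e₁′ = solve-∀
  e₂ : ∀ σ u v w n N j t → σ + suc j * u + 2 * (v + N) + (w + w) + (n + j * (v + w) + t)
                         ≡ u + v + w + n + suc j * (v + w) + t + (σ + j * u + 2 * N)
  e₂ = solve-∀
  b₀ : ∀ j → σ + j * v + 2 * (v + N) ≤ u + v + w + n + j * (w + u) + T j
  b₀ j = ≤-by 0 (bound₁ B j) (e₀ σ u v w n N j (T j))
  b₁ : ∀ j → σ + suc j * w + 2 * (v + N) ≤ u + v + w + n + suc j * (v + u) + T j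
  -- Since -k₁ = k₂ + 2 u, the gain supplies one unit of the slope. What remains here is slope 0,
  -- available only from `bound₀`.
  b₁ zero    = ≤-by (u + u) (bound₀ B 0) (e₁ σ u v w n N)
  b₁ (suc j) = ≤-by (u + u + suc j) (bound₂ B j) (e₁′ σ u v w n N j (T j))
  b₂ : ∀ j → σ + suc j * u + 2 * (v + N) ≤ u + v + w + n + suc j * (v + w) + T j
  b₂ j = ≤-by (w + w) (bound₀ B j) (e₂ σ u v w n N j (T j))

-- This serves two rows that are both lengthened by three H's of different classes: each gains three
-- boxes, one of them counted, so n - 2 N grows by 2. The three k's all drop by 1, which only
-- relaxes the bounds.
Bounded-shift : ∀ {u v w n N} → Bounded 0 u v w n N → Bounded 2 (suc u) (suc v) (suc w) (6 + n) (2 + N)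
Bounded-shift {u} {v} {w} {n} {N} B =
  bounds (λ j → ≤-by j (bound₀ B j) (e₀ u v w n N j (T j)))
         (λ j → ≤-by (suc j) (bound₁ B j) (e₁ u v w n N j (T j)))
         (λ j → ≤-by (suc j) (bound₂ B j) (e₁ u w v n N j (T j)))
  where
  e₀ : ∀ u v w n N j t → 2 + j * suc u + 2 * (2 + N) + j + (n + j * (v + w) + t)
                       ≡ 6 + n + j * (suc v + suc w) + t + (j * u + 2 * N)
  e₀ = solve-∀
  e₁ : ∀ u v w n N j t → 2 + suc j * suc v + 2 * (2 + N) + suc j + (n + suc j * (u + w) + t)
                       ≡ 6 + n + suc j * (suc u + suc w) + t + (suc j * v + 2 * N)
  e₁ = solve-∀

-- Continuations that force n - 2 N ≥ 2 forever.

stairsSize stairsWt : ℕ → ℕ → ℕ → ℕ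
stairsSize a b c = T a + (suc a * b + T b) + ((a + b + 2) * c + T c)
stairsWt   a b c = a * b + b * c + b + c

-- The triangular numbers of sums are expanded, so that the ring identities below need T only at
-- single variables, as atoms.
product≤T₂₂ : ∀ p q r s → (p + q) * (r + s) + (p + q) ≤ (T p + T q + p * q) + (T r + T s + r * s)
product≤T₂₂ p q r s =
  subst ((p + q) * (r + s) + (p + q) ≤_) (cong₂ _+_ (T-+ p q) (T-+ r s)) (product≤T+T (p + q) (r + s))

product≤T₁₃ : ∀ p q r s → p * (q + r + s) + p ≤ T p + (T q + T r + q * r + T s + (q + r) * s)
product≤T₁₃ p q r s = subst (λ t → p * (q + r + s) + p ≤ T p + t)
  (trans (T-+ (q + r) s) (cong (λ t → t + T s + (q + r) * s) (T-+ q r))) (product≤T+T p (q + r + s))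

-- The last V of (HV)ᵃ V adds a boxes and none that is counted. For a = 1 the bound fails, because
-- one more V brings n - 2 N down to 1; hence a ≥ 2.
Bounded-AV : ∀ d → let a = suc (suc d) in
  Bounded 2 0 a 0 (0 + 0 + a + stairsSize a 0 0) (0 + stairsWt a 0 0)
Bounded-AV d = bounds
  (λ j → ≤-by (d + T a + j * a + T j) z≤n (e₀ d j (T a) (T j)))
  (λ j → ≤-by d (product≤T+T a j) (e₁ d j (T a) (T j)))
  (λ j → ≤-by (d + T a + suc j * a + T j) z≤n (e₂ d j (T a) (T j)))
  where
  a = suc (suc d)
  e₀ : ∀ d j s t → let a = suc (suc d) in
    2 + j * 0 + 2 * (0 + (a * 0 + 0 * 0 + 0 + 0)) + (d + s + j * a + t) + 0
    ≡ 0 + 0 + a + (s + (suc a * 0 + 0) + ((a + 0 + 2) * 0 + 0)) + j * (a + 0) + t + 0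
  e₀ = solve-∀
  e₁ : ∀ d j s t → let a = suc (suc d) in
    2 + suc j * a + 2 * (0 + (a * 0 + 0 * 0 + 0 + 0)) + d + (s + t)
    ≡ 0 + 0 + a + (s + (suc a * 0 + 0) + ((a + 0 + 2) * 0 + 0)) + suc j * (0 + 0) + t + (a * j + a)
  e₁ = solve-∀
  e₂ : ∀ d j s t → let a = suc (suc d) in
    2 + suc j * 0 + 2 * (0 + (a * 0 + 0 * 0 + 0 + 0)) + (d + s + suc j * a + t) + 0
    ≡ 0 + 0 + a + (s + (suc a * 0 + 0) + ((a + 0 + 2) * 0 + 0)) + suc j * (0 + a) + t + 0
  e₂ = solve-∀

Bounded-BV : ∀ a d → let b = suc d in
  Bounded 2 0 b (suc a) (suc a + 0 + b + stairsSize a b 0) (0 + stairsWt a b 0)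
Bounded-BV a d = bounds
  (λ j → ≤-by (a + d + j * (b + suc a) + T j) (product≤T+T b a) (e₀ a d j (T a) (T b) (T j)))
  (λ j → ≤-by (a + d) (product≤T₂₂ b 0 a (suc j)) (e₁ a d j (T a) (T b) (T j)))
  (λ j → ≤-by (d + d) (product≤T₂₂ b j a 0) (e₂ a d j (T a) (T b) (T j)))
  where
  b = suc d
  e₀ : ∀ a d j r s t → let b = suc d in
    2 + j * 0 + 2 * (0 + (a * b + b * 0 + b + 0)) + (a + d + j * (b + suc a) + t) + (s + r)
    ≡ suc a + 0 + b + (r + (suc a * b + s) + ((a + b + 2) * 0 + 0)) + j * (b + suc a) + t + (b * a + b)
  e₀ = solve-∀
  e₁ : ∀ a d j r s t → let b = suc d in
    2 + suc j * b + 2 * (0 + (a * b + b * 0 + b + 0)) + (a + d)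
      + ((s + 0 + b * 0) + (r + (suc j + t) + a * suc j))
    ≡ suc a + 0 + b + (r + (suc a * b + s) + ((a + b + 2) * 0 + 0)) + suc j * (0 + suc a) + t
      + ((b + 0) * (a + suc j) + (b + 0))
  e₁ = solve-∀
  e₂ : ∀ a d j r s t → let b = suc d in
    2 + suc j * suc a + 2 * (0 + (a * b + b * 0 + b + 0)) + (d + d)
      + ((s + t + b * j) + (r + 0 + a * 0))
    ≡ suc a + 0 + b + (r + (suc a * b + s) + ((a + b + 2) * 0 + 0)) + suc j * (0 + b) + t
      + ((b + j) * (a + 0) + (b + j))
  e₂ = solve-∀

Bounded-CV : ∀ a b d → let c = suc d in
  Bounded 2 (suc a) c (suc b) (suc b + suc a + c + stairsSize a b c) (suc a + stairsWt a b c)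
Bounded-CV a b d = bounds
  (λ j → ≤-by (d + d + (c * j + c * j)) (product≤T₂₂ a c b j) (e₀ a b d j (T a) (T b) (T c) (T j)))
  (λ j → ≤-by (d + d + suc j * (a + a + 1)) (product≤T₂₂ a c b (suc j)) (e₁ a b d j (T a) (T b) (T c) (T j)))
  (λ j → ≤-by (d + d) (product≤T₁₃ b a c j) (e₂ a b d j (T a) (T b) (T c) (T j)))
  where
  c = suc d
  e₀ : ∀ a b d j r s q t → let c = suc d in
    2 + j * suc a + 2 * (suc a + (a * b + b * c + b + c)) + (d + d + (c * j + c * j))
      + ((r + q + a * c) + (s + t + b * j))
    ≡ suc b + suc a + c + (r + (suc a * b + s) + ((a + b + 2) * c + q)) + j * (c + suc b) + t
      + ((a + c) * (b + j) + (a + c))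
  e₀ = solve-∀
  e₁ : ∀ a b d j r s q t → let c = suc d in
    2 + suc j * c + 2 * (suc a + (a * b + b * c + b + c)) + (d + d + suc j * (a + a + 1))
      + ((r + q + a * c) + (s + (suc j + t) + b * suc j))
    ≡ suc b + suc a + c + (r + (suc a * b + s) + ((a + b + 2) * c + q)) + suc j * (suc a + suc b) + t
      + ((a + c) * (b + suc j) + (a + c))
  e₁ = solve-∀
  e₂ : ∀ a b d j r s q t → let c = suc d in
    2 + suc j * suc b + 2 * (suc a + (a * b + b * c + b + c)) + (d + d)
      + (s + (r + q + a * c + t + (a + c) * j))
    ≡ suc b + suc a + c + (r + (suc a * b + s) + ((a + b + 2) * c + q)) + suc j * (suc a + c) + t
      + (b * (a + c + j) + b)
  e₂ = solve-∀

Bounded-FV : ∀ a b c →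
  Bounded 2 (suc c) (suc b) (suc (suc a))
    (suc (suc a) + suc c + suc b + stairsSize a b c) (suc c + stairsWt a b c)
Bounded-FV a b c = bounds
  (λ j → ≤-by (a + a + j * (a + a + 2)) (product≤T₂₂ a c b j) (e₀ a b c j (T a) (T b) (T c) (T j)))
  (λ j → ≤-by (a + a + (suc j + suc j)) (product≤T₁₃ b a c j) (e₁ a b c j (T a) (T b) (T c) (T j)))
  (λ j → ≤-by (a + b + c + (c * j + c * j)) (product≤T₂₂ a c b j) (e₂ a b c j (T a) (T b) (T c) (T j)))
  where
  e₀ : ∀ a b c j r s q t →
    2 + j * suc c + 2 * (suc c + (a * b + b * c + b + c)) + (a + a + j * (a + a + 2))
      + ((r + q + a * c) + (s + t + b * j))
    ≡ suc (suc a) + suc c + suc b + (r + (suc a * b + s) + ((a + b + 2) * c + q))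
      + j * (suc b + suc (suc a)) + t + ((a + c) * (b + j) + (a + c))
  e₀ = solve-∀
  e₁ : ∀ a b c j r s q t →
    2 + suc j * suc b + 2 * (suc c + (a * b + b * c + b + c)) + (a + a + (suc j + suc j))
      + (s + (r + q + a * c + t + (a + c) * j))
    ≡ suc (suc a) + suc c + suc b + (r + (suc a * b + s) + ((a + b + 2) * c + q))
      + suc j * (suc c + suc (suc a)) + t + (b * (a + c + j) + b)
  e₁ = solve-∀
  e₂ : ∀ a b c j r s q t →
    2 + suc j * suc (suc a) + 2 * (suc c + (a * b + b * c + b + c)) + (a + b + c + (c * j + c * j))
      + ((r + q + a * c) + (s + t + b * j))
    ≡ suc (suc a) + suc c + suc b + (r + (suc a * b + s) + ((a + b + 2) * c + q))
      + suc j * (suc c + suc b) + t + ((a + c) * (b + j) + (a + c))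
  e₂ = solve-∀

-- Boundary words and the staircases.

-- Run x λ′ u v w n N: some prefix of a boundary word has produced the rows λ′ and reached abscissa x.
-- Its numbers of H's whose class is 0, 1, 2 above the current height are u, v, w, and n = |λ′|, N = wt λ′.
data Run : ℕ → List ℕ → ℕ → ℕ → ℕ → ℕ → ℕ → Set where
  start : Run 0 [] 0 0 0 0 0
  H     : ∀ {x λ′ u v w n N} → Run x λ′ u v w n N → Run (suc x) λ′ (suc w) u v n N
  V     : ∀ {x λ′ u v w n N} → 0 < x → Run x λ′ u v w n N → Run x (x ∷ λ′) v w u (u + v + w + n) (v + N)

Run-bounded : ∀ {x λ′ u v w n N} → Run x λ′ u v w n N → Bounded 0 u v w n N
Run-bounded start   = bounds (λ j → subst (_≤ j * 0 + T j) (sym (cong (_+ 0) (*-zeroʳ j))) z≤n)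
                             (λ j → subst (_≤ j * 0 + T j) (sym (cong (_+ 0) (*-zeroʳ j))) z≤n)
                             (λ j → subst (_≤ j * 0 + T j) (sym (cong (_+ 0) (*-zeroʳ j))) z≤n)
Run-bounded (H r)   = Bounded-H (Run-bounded r)
Run-bounded (V _ r) = Bounded-V (Run-bounded r)

ladder : ℕ → ℕ → List ℕ → List ℕ
ladder zero    x λ′ = λ′
ladder (suc k) x λ′ = suc k + x ∷ ladder k x λ′

-- These are the rows of (HV)ᵃ H (HV)ᵇ H (HV)ᶜ; each `suc` in an offset is one of the two extra H's.
-- The form `a + 0` is the abscissa as `ladder` produces it.
stairs : ℕ → ℕ → ℕ → List ℕ
stairs a b c = ladder c (suc (b + suc (a + 0))) (ladder b (suc (a + 0)) (ladder a 0 []))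

Run-subst : ∀ {x λ′ u v w n n′ N N′} → n ≡ n′ → N ≡ N′ → Run x λ′ u v w n N → Run x λ′ u v w n′ N′
Run-subst refl refl r = r

-- abstract keeps the injectivity analysis of Run-A and Run-C from evaluating these solver proofs.
abstract
  stairsSize-sucA : ∀ a → suc a + 0 + 0 + stairsSize a 0 0 ≡ stairsSize (suc a) 0 0
  stairsSize-sucA a = lemma a (T a)
    where
    lemma : ∀ a s → suc a + 0 + 0 + (s + (suc a * 0 + 0) + ((a + 0 + 2) * 0 + 0))
                  ≡ suc a + s + (suc (suc a) * 0 + 0) + ((suc a + 0 + 2) * 0 + 0)
    lemma = solve-∀

  stairsWt-sucA : ∀ a → 0 + stairsWt a 0 0 ≡ stairsWt (suc a) 0 0
  stairsWt-sucA = lemma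
    where
    lemma : ∀ a → 0 + (a * 0 + 0 + 0 + 0) ≡ suc a * 0 + 0 + 0 + 0
    lemma = solve-∀

  stairsSize-sucB : ∀ a b → suc b + suc a + 0 + stairsSize a b 0 ≡ stairsSize a (suc b) 0
  stairsSize-sucB a b = lemma a b (T a) (T b)
    where
    lemma : ∀ a b r s → suc b + suc a + 0 + (r + (suc a * b + s) + ((a + b + 2) * 0 + 0))
                      ≡ r + (suc a * suc b + (suc b + s)) + ((a + suc b + 2) * 0 + 0)
    lemma = solve-∀

  stairsWt-sucB : ∀ a b → suc a + stairsWt a b 0 ≡ stairsWt a (suc b) 0
  stairsWt-sucB = lemma
    where
    lemma : ∀ a b → suc a + (a * b + b * 0 + b + 0) ≡ a * suc b + suc b * 0 + suc b + 0
    lemma = solve-∀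

  stairsSize-sucC : ∀ a b c → suc c + suc b + suc a + stairsSize a b c ≡ stairsSize a b (suc c)
  stairsSize-sucC a b c = lemma a b c (T a) (T b) (T c)
    where
    lemma : ∀ a b c r s t → suc c + suc b + suc a + (r + (suc a * b + s) + ((a + b + 2) * c + t))
                          ≡ r + (suc a * b + s) + ((a + b + 2) * suc c + (suc c + t))
    lemma = solve-∀

  stairsWt-sucC : ∀ a b c → suc b + stairsWt a b c ≡ stairsWt a b (suc c)
  stairsWt-sucC = lemma
    where
    lemma : ∀ a b c → suc b + (a * b + b * c + b + c) ≡ a * b + b * suc c + b + suc c
    lemma = solve-∀

positive : ∀ k {m} → 0 < k + suc m
positive k {m} = ≤-trans (s≤s z≤n) (m≤n+m (suc m) k)

Run-A : ∀ a → Run (a + 0) (ladder a 0 []) 0 0 a (stairsSize a 0 0) (stairsWt a 0 0)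
Run-A zero    = start
Run-A (suc a) = Run-subst (stairsSize-sucA a) (stairsWt-sucA a) (V (s≤s z≤n) (H (Run-A a)))

-- The word (HV)ᵃ H (HV)ᵇ H is read as (HV)ᵃ H H (VH)ᵇ, so that the induction on b appends at its
-- end.
Run-B′ : ∀ a b → Run (suc (b + suc (a + 0))) (stairs a b 0) (suc b) (suc a) 0 (stairsSize a b 0) (stairsWt a b 0)
Run-B′ a zero    = H (H (Run-A a))
Run-B′ a (suc b) = H (Run-subst (stairsSize-sucB a b) (stairsWt-sucB a b) (V (s≤s z≤n) (Run-B′ a b)))

Run-C′ : ∀ a b c → Run (suc (c + suc (b + suc (a + 0)))) (stairs a b c) (suc c) (suc b) (suc a)
                       (stairsSize a b c) (stairsWt a b c)
Run-C′ a b zero    = H (Run-B′ a b)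
Run-C′ a b (suc c) = H (Run-subst (stairsSize-sucC a b c) (stairsWt-sucC a b c) (V (s≤s z≤n) (Run-C′ a b c)))

Run-C : ∀ a b c → Run (c + suc (b + suc (a + 0))) (stairs a b c) (suc b) (suc a) c
                      (stairsSize a b c) (stairsWt a b c)
Run-C a b zero    = Run-B′ a b
Run-C a b (suc c) = Run-subst (stairsSize-sucC a b c) (stairsWt-sucC a b c) (V (s≤s z≤n) (Run-C′ a b c))

-- Classification of all boundary words.

threeOnes : List ℕ
threeOnes = 1 ∷ 1 ∷ 1 ∷ []

-- The words are, with a, b, c ≥ 0:
--   A (HV)ᵃ,  A′ (HV)ᵃ H,  B (HV)ᵃ H (HV)ᵇ⁺¹,  B′ (HV)ᵃ H (HV)ᵇ H,
--   C (HV)ᵃ H (HV)ᵇ H (HV)ᶜ⁺¹,  C′ (HV)ᵃ H (HV)ᵇ H (HV)ᶜ H,  F (HV)ᵃ H (HV)ᵇ H (HV)ᶜ H H;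
-- the others are named after an inserted closed walk.  A deficient word has |λ| - 2 wt ≥ 2 however it is continued.
data Class : ℕ → List ℕ → ℕ → ℕ → ℕ → ℕ → ℕ → Set where
  deficient : ∀ {x λ′ u v w n N} → Bounded 2 u v w n N → Class x λ′ u v w n N
  A  : ∀ a {n N} → n ≡ stairsSize a 0 0 → N ≡ stairsWt a 0 0 →
       Class (a + 0) (ladder a 0 []) 0 0 a n N
  A′ : ∀ a {n N} → n ≡ stairsSize a 0 0 → N ≡ stairsWt a 0 0 →
       Class (suc (a + 0)) (ladder a 0 []) (suc a) 0 0 n N
  B  : ∀ a b {n N} → n ≡ stairsSize a (suc b) 0 → N ≡ stairsWt a (suc b) 0 →
       Class (suc b + suc (a + 0)) (stairs a (suc b) 0) (suc a) 0 (suc b) n N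
  B′ : ∀ a b {n N} → n ≡ stairsSize a b 0 → N ≡ stairsWt a b 0 →
       Class (suc (b + suc (a + 0))) (stairs a b 0) (suc b) (suc a) 0 n N
  C  : ∀ a b c {n N} → n ≡ stairsSize a b (suc c) → N ≡ stairsWt a b (suc c) →
       Class (suc c + suc (b + suc (a + 0))) (stairs a b (suc c)) (suc b) (suc a) (suc c) n N
  C′ : ∀ a b c {n N} → n ≡ stairsSize a b c → N ≡ stairsWt a b c →
       Class (suc (c + suc (b + suc (a + 0)))) (stairs a b c) (suc c) (suc b) (suc a) n N
  F  : ∀ a b c {n N} → n ≡ stairsSize a b c → N ≡ stairsWt a b c →
       Class (suc (suc (c + suc (b + suc (a + 0))))) (stairs a b c) (suc (suc a)) (suc c) (suc b) n N
  HVV  : Class 1 (1 ∷ 1 ∷ []) 0 1 0 2 0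
  HHH  : ∀ {x λ′ u v w n N} → 0 < x → Run x λ′ u v w n N → Class (3 + x) λ′ (suc u) (suc v) (suc w) n N
  HHHV : ∀ {x y λ′ u v w n N n′ N′} → Run x (y ∷ λ′) u v w n N → n′ ≡ 3 + n → N′ ≡ 1 + N →
         Class (3 + x) (3 + y ∷ λ′) (suc u) (suc v) (suc w) n′ N′
  HVVV : ∀ {x λ′ u v w n N n′ N′} → 0 < x → Run x λ′ u v w n N → n′ ≡ 3 + n → N′ ≡ 1 + N →
         Class x (λ′ ++ threeOnes) u v w n′ N′

-- HVV itself is not `Bounded 2`, because HVVV has n - 2 N = 1. Once an H follows, that way back is
-- closed.
Bounded-HVVH : Bounded 2 1 0 1 2 0
Bounded-HVVH = bounds
  (λ j → ≤-by (T j) z≤n (e₀ j (T j)))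
  (λ j → ≤-by (suc j + suc j + T j) z≤n (e₁ j (T j)))
  (λ j → ≤-by (T j) z≤n (e₂ j (T j)))
  where
  e₀ : ∀ j t → 2 + j * 1 + 0 + t + 0 ≡ 2 + j * 1 + t + 0
  e₀ = solve-∀
  e₁ : ∀ j t → 2 + suc j * 0 + 0 + (suc j + suc j + t) + 0 ≡ 2 + suc j * (1 + 1) + t + 0
  e₁ = solve-∀
  e₂ : ∀ j t → 2 + suc j * 1 + 0 + t + 0 ≡ 2 + suc j * (1 + 0) + t + 0
  e₂ = solve-∀

Class-H : ∀ {x λ′ u v w n N} → Class x λ′ u v w n N → Class (suc x) λ′ (suc w) u v n N
Class-H (deficient d)        = deficient (Bounded-H d)
Class-H (A a p q)            = A′ a p q
Class-H (A′ a p q)           = B′ a 0 p q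
Class-H (B a b p q)          = B′ a (suc b) p q
Class-H (B′ a b p q)         = C′ a b 0 p q
Class-H (C a b c p q)        = C′ a b (suc c) p q
Class-H (C′ a b c p q)       = F a b c p q
-- With the third H in a row, all three become an inserted HHH that awaits its V.
Class-H (F a b c refl refl)  = HHH (positive c) (Run-C a b c)
Class-H HVV                  = deficient Bounded-HVVH
-- In a longer row of H's the inserted three are always taken to be the last.
Class-H (HHH _ r)            = HHH (s≤s z≤n) (H r)
Class-H (HHHV r p q)         = HHHV (H r) p q
Class-H (HVVV _ r p q)       = HVVV (s≤s z≤n) (H r) p q

Class-V : ∀ {x λ′ u v w n N} → 0 < x → Class x λ′ u v w n N →
          Class x (x ∷ λ′) v w u (u + v + w + n) (v + N)
Class-V _   (deficient d)                      = deficient (Bounded-V d)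
Class-V ()  (A zero p q)
Class-V _   (A (suc zero) refl refl)           = HVV
Class-V _   (A (suc (suc d)) refl refl)        = deficient (Bounded-AV d)
Class-V _   (A′ a refl refl)                   = A (suc a) (stairsSize-sucA a) (stairsWt-sucA a)
Class-V _   (B a b refl refl)                  = deficient (Bounded-BV a b)
Class-V _   (B′ a b refl refl)                 = B a b (stairsSize-sucB a b) (stairsWt-sucB a b)
Class-V _   (C a b c refl refl)                = deficient (Bounded-CV a b c)
Class-V _   (C′ a b c refl refl)               = C a b c (stairsSize-sucC a b c) (stairsWt-sucC a b c)
Class-V _   (F a b c refl refl)                = deficient (Bounded-FV a b c)
Class-V _   HVV                                = HVVV (s≤s z≤n) (H start) refl refl
Class-V _   (HHH {u = u} {v} {w} {n} x>0 r)    = HHHV (V x>0 r) (lemma u v w n) refl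
  where
  lemma : ∀ u v w n → suc u + suc v + suc w + n ≡ 3 + (u + v + w + n)
  lemma = solve-∀
Class-V _   (HHHV {u = u} {v} {w} {n} {N} r refl refl) =
  -- Without HHH the word is an ordinary run followed by V; with it, the last two rows are both
  -- longer by 3.
  deficient (subst₂ (Bounded 2 (suc v) (suc w) (suc u)) (size-lemma u v w n) (wt-lemma v N)
    (Bounded-shift (Bounded-V (Run-bounded r))))
  where
  size-lemma : ∀ u v w n → 6 + (u + v + w + n) ≡ suc u + suc v + suc w + (3 + n)
  size-lemma = solve-∀
  wt-lemma : ∀ v N → 2 + (v + N) ≡ suc v + (1 + N)
  wt-lemma = solve-∀
Class-V _   (HVVV {u = u} {v} {w} {n} {N} x>0 r refl refl) = HVVV x>0 (V x>0 r) (size-lemma u v w n) (wt-lemma v N)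
  where
  size-lemma : ∀ u v w n → u + v + w + (3 + n) ≡ 3 + (u + v + w + n)
  size-lemma = solve-∀
  wt-lemma : ∀ v N → v + (1 + N) ≡ 1 + (v + N)
  wt-lemma = solve-∀

classify : ∀ {x λ′ u v w n N} → Run x λ′ u v w n N → Class x λ′ u v w n N
classify start     = A 0 refl refl
classify (H r)     = Class-H (classify r)
classify (V x>0 r) = Class-V x>0 (classify r)

-- The weight as a sum over rows.

sumTo : (ℕ → ℕ) → ℕ → ℕ
sumTo f zero    = 0
sumTo f (suc n) = f 0 + sumTo (f ∘ suc) n

sumTo-suc : ∀ f n → sumTo f (suc n) ≡ sumTo f n + f n
sumTo-suc f zero    = +-identityʳ (f 0)
sumTo-suc f (suc n) = trans (cong (f 0 +_) (sumTo-suc (f ∘ suc) n)) (sym (+-assoc (f 0) _ _))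

sumTo-cong : ∀ {f g} n → (∀ i → i < n → f i ≡ g i) → sumTo f n ≡ sumTo g n
sumTo-cong zero    eq = refl
sumTo-cong (suc n) eq = cong₂ _+_ (eq 0 (s≤s z≤n)) (sumTo-cong n (λ i i<n → eq (suc i) (s≤s i<n)))

bit : Bool → ℕ
bit b = if b then 1 else 0

length-filterᵇ-map : ∀ {A : Set} (p : A → Bool) (f : ℕ → A) g n →
  length (filterᵇ p (map f (applyUpTo g n))) ≡ sumTo (bit ∘ p ∘ f ∘ g) n
length-filterᵇ-map p f g zero    = refl
length-filterᵇ-map p f g (suc n) with p (f (g 0))
... | true  = cong suc (length-filterᵇ-map p f (g ∘ suc) n)
... | false = length-filterᵇ-map p f (g ∘ suc) n

length-filterᵇ-concatMap : ∀ {A : Set} (p : A → Bool) (f : ℕ → List A) g n →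
  length (filterᵇ p (concatMap f (applyUpTo g n))) ≡ sumTo (length ∘ filterᵇ p ∘ f ∘ g) n
length-filterᵇ-concatMap p f g zero    = refl
length-filterᵇ-concatMap p f g (suc n) =
  trans (cong length (filter-++ (T? ∘ p) (f (g 0)) _))
    (trans (length-++ (filterᵇ p (f (g 0))))
      (cong (length (filterᵇ p (f (g 0))) +_) (length-filterᵇ-concatMap p f (g ∘ suc) n)))

rowWt : List ℕ → ℕ → ℕ
rowWt λ′ i = sumTo (λ j → bit (cond λ′ (i , j))) (part λ′ i)

wtZ3-rows : ∀ λ′ → wtZ3 λ′ ≡ sumTo (rowWt λ′) (length λ′)
wtZ3-rows λ′ = trans (length-filterᵇ-concatMap (cond λ′) _ id (length λ′))
  (sumTo-cong (length λ′) (λ i _ → length-filterᵇ-map (cond λ′) (i ,_) id (part λ′ i)))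

_≡₃_ : ℕ → ℕ → Bool
a ≡₃ b = does (a % 3 ≟ b % 3)

suc-≡₃ : ∀ a b → (suc a ≡₃ suc b) ≡ (a ≡₃ b)
-- Two further increments undo the first, since `(3 + a) % 3` computes to `a % 3`.
suc-≡₃ a b = does-⇔ (mk⇔ (λ eq → step {suc (suc a)} {suc (suc b)} (step {suc a} {suc b} eq)) (step {a} {b}))
  (suc a % 3 ≟ suc b % 3) (a % 3 ≟ b % 3)
  where
  step : ∀ {a b} → a % 3 ≡ b % 3 → suc a % 3 ≡ suc b % 3
  step {a} {b} eq = trans (%-distribˡ-+ 1 a 3)
    (trans (cong (λ r → (1 + r) % 3) eq) (sym (%-distribˡ-+ 1 b 3)))

cond-≡₃ : ∀ λ′ i j → cond λ′ (i , j) ≡ ((arm λ′ i j + 1) ≡₃ leg λ′ i j)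
cond-≡₃ λ′ i j with (arm λ′ i j + 1) % 3 ≟ leg λ′ i j % 3
... | yes p = sym (dec-true (_ ≟ _) p)
... | no ¬p = sym (dec-false (_ ≟ _) ¬p)

colHeight-covered : ∀ {x j} λ′ → j < x → colHeight (x ∷ λ′) j ≡ suc (colHeight λ′ j)
colHeight-covered {x} {j} λ′ j<x =
  cong (λ b → (if b then 1 else 0) + colHeight λ′ j) (Equivalence.to T-≡ (<⇒<ᵇ j<x))

colHeight-beyond : ∀ {x λ′} → All (_≤ x) λ′ → colHeight λ′ x ≡ 0
colHeight-beyond []                      = refl
colHeight-beyond {x} {y ∷ λ′} (y≤x ∷ rest) with suc x ≤ᵇ y in eq
... | false = colHeight-beyond rest
... | true  = contradiction (<ᵇ⇒< x y (Equivalence.from T-≡ eq)) (≤⇒≯ y≤x)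

part-≤ : ∀ {x λ′} → All (_≤ x) λ′ → ∀ i → part λ′ i ≤ x
part-≤ []           i       = z≤n
part-≤ (y≤x ∷ rest) zero    = y≤x
part-≤ (y≤x ∷ rest) (suc i) = part-≤ rest i

-- With the row of length x about to be closed below λ′, this counts its boxes with r + arm ≡ leg (mod 3).
legCount : ℕ → List ℕ → ℕ → ℕ
legCount r λ′ x = sumTo (λ j → bit ((r + colHeight λ′ j) ≡₃ (x ∸ suc j))) x

-- The new bottom row covers every column of λ′. It raises column heights and row indices by one
-- alike, so the old boxes keep their arms and legs, and the arm of a new box is the old height of
-- its column.
wtZ3-∷ : ∀ {x λ′} → All (_≤ x) λ′ → wtZ3 (x ∷ λ′) ≡ legCount 1 λ′ x + wtZ3 λ′
wtZ3-∷ {x} {λ′} all≤ = trans (wtZ3-rows (x ∷ λ′)) (cong₂ _+_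
  (sumTo-cong x (λ j j<x → cong bit (first-row j j<x)))
  (trans (sumTo-cong (length λ′) (λ i _ → sumTo-cong (part λ′ i)
           (λ j j<p → cong bit (higher-row i j (<-≤-trans j<p (part-≤ all≤ i))))))
         (sym (wtZ3-rows λ′))))
  where
  first-row : ∀ j → j < x → cond (x ∷ λ′) (0 , j) ≡ ((1 + colHeight λ′ j) ≡₃ (x ∸ suc j))
  first-row j j<x rewrite cond-≡₃ (x ∷ λ′) 0 j | colHeight-covered λ′ j<x | +-comm (colHeight λ′ j) 1 = refl
  higher-row : ∀ i j → j < x → cond (x ∷ λ′) (suc i , j) ≡ cond λ′ (i , j)
  higher-row i j j<x rewrite cond-≡₃ (x ∷ λ′) (suc i) j | cond-≡₃ λ′ i j | colHeight-covered λ′ j<x = refl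

-- Lengthening the pending row adds one to every leg, which `suc r` compensates. The new last box
-- has arm and leg 0.
legCount-suc : ∀ r {x λ′} → All (_≤ x) λ′ → legCount (suc r) λ′ (suc x) ≡ legCount r λ′ x + bit (suc r ≡₃ 0)
legCount-suc r {x} {λ′} all≤ = trans (sumTo-suc _ x) (cong₂ _+_
  (sumTo-cong x (λ j j<x → cong bit (inner j j<x)))
  (cong bit (cong₂ _≡₃_ (trans (cong (suc r +_) (colHeight-beyond all≤)) (+-identityʳ (suc r))) (n∸n≡0 x))))
  where
  inner : ∀ j → j < x → ((suc r + colHeight λ′ j) ≡₃ (x ∸ j)) ≡ ((r + colHeight λ′ j) ≡₃ (x ∸ suc j))
  inner j j<x = trans (cong ((suc r + colHeight λ′ j) ≡₃_) (+-∸-assoc 1 j<x))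
                      (suc-≡₃ (r + colHeight λ′ j) (x ∸ suc j))

legCount-∷ : ∀ r x λ′ → legCount r (x ∷ λ′) x ≡ legCount (suc r) λ′ x
legCount-∷ r x λ′ = sumTo-cong x (λ j j<x → cong (λ h → bit (h ≡₃ (x ∸ suc j)))
  (trans (cong (r +_) (colHeight-covered λ′ j<x)) (+-suc r _)))

-- Translation between runs and partitions.

Run-parts≤ : ∀ {x λ′ u v w n N} → Run x λ′ u v w n N → All (_≤ x) λ′
Run-parts≤ start   = []
Run-parts≤ (H r)   = All.map m≤n⇒m≤1+n (Run-parts≤ r)
Run-parts≤ (V _ r) = ≤-refl ∷ Run-parts≤ r

-- This identifies the classes of the H's with arms and legs: column j belongs to an H whose class
-- is r above the current height exactly when r + arm ≡ leg (mod 3) for its box in the pending row.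
-- For r = 1 this is the condition that the weight counts.
Run-legCount : ∀ {x λ′ u v w n N} → Run x λ′ u v w n N →
  legCount 0 λ′ x ≡ u × legCount 1 λ′ x ≡ v × legCount 2 λ′ x ≡ w
Run-legCount start = refl , refl , refl
Run-legCount (H r) with Run-parts≤ r | Run-legCount r
... | all≤ | refl , refl , refl =
  -- `legCount 3` computes to `legCount 0`.
  trans (legCount-suc 2 all≤) (+-comm _ 1) ,
  trans (legCount-suc 0 all≤) (+-identityʳ _) ,
  trans (legCount-suc 1 all≤) (+-identityʳ _)
Run-legCount (V {x} {λ′} _ r) with Run-legCount r
... | refl , refl , refl = legCount-∷ 0 x λ′ , legCount-∷ 1 x λ′ , legCount-∷ 2 x λ′

Run-wt : ∀ {x λ′ u v w n N} → Run x λ′ u v w n N → wtZ3 λ′ ≡ N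
Run-wt start   = refl
Run-wt (H r)   = Run-wt r
Run-wt (V _ r) = trans (wtZ3-∷ (Run-parts≤ r)) (cong₂ _+_ (proj₁ (proj₂ (Run-legCount r))) (Run-wt r))

Run-width : ∀ {x λ′ u v w n N} → Run x λ′ u v w n N → x ≡ u + v + w
Run-width start = refl
Run-width (H {u = u} {v} {w} r) = trans (cong suc (Run-width r)) (lemma u v w)
  where
  lemma : ∀ u v w → suc (u + v + w) ≡ suc w + u + v
  lemma = solve-∀
Run-width (V {u = u} {v} {w} _ r) = trans (Run-width r) (lemma u v w)
  where
  lemma : ∀ u v w → u + v + w ≡ v + w + u
  lemma = solve-∀

Run-size : ∀ {x λ′ u v w n N} → Run x λ′ u v w n N → sum λ′ ≡ n
Run-size start   = refl
Run-size (H r)   = Run-size r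
Run-size (V _ r) = cong₂ _+_ (Run-width r) (Run-size r)

Run-IsPartition : ∀ {x λ′ u v w n N} → Run x λ′ u v w n N → IsPartition λ′
Run-IsPartition start = [] , []
Run-IsPartition (H r) = Run-IsPartition r
Run-IsPartition (V {x} {λ′} x>0 r) with Run-IsPartition r
... | linked , pos = cons (Run-parts≤ r) linked , x>0 ∷ pos
  where
  cons : ∀ {μ} → All (_≤ x) μ → Linked _≥_ μ → Linked _≥_ (x ∷ μ)
  cons []        []  = [-]
  cons (y≤x ∷ _) [-] = y≤x ∷ [-]
  cons (y≤x ∷ _) (q ∷ l) = y≤x ∷ q ∷ l

head₀ : List ℕ → ℕ
head₀ λ′ = part λ′ 0

Reachable : ℕ → List ℕ → Set
Reachable x λ′ = ∃ λ u → ∃ λ v → ∃ λ w → ∃ λ n → ∃ λ N → Run x λ′ u v w n N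

widen : ∀ d {x λ′} → Reachable x λ′ → Reachable (d + x) λ′
widen zero    r = r
widen (suc d) r with widen d r
... | _ , _ , _ , _ , _ , r′ = _ , _ , _ , _ , _ , H r′

head₀-≤ : ∀ {x λ′} → Linked _≥_ (x ∷ λ′) → head₀ λ′ ≤ x
head₀-≤ [-]       = z≤n
head₀-≤ (y≤x ∷ _) = y≤x

-- The word is read off the rows from the top: each row contributes as many H's as it exceeds the
-- previous one, then a V.
IsPartition⇒Reachable : ∀ λ′ → IsPartition λ′ → Reachable (head₀ λ′) λ′
IsPartition⇒Reachable []       _ = _ , _ , _ , _ , _ , start
IsPartition⇒Reachable (x ∷ λ′) (linked , x>0 ∷ pos)
  with subst (λ y → Reachable y λ′) (m∸n+n≡m (head₀-≤ linked))
         (widen (x ∸ head₀ λ′) (IsPartition⇒Reachable λ′ (Linked.tail linked , pos)))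
... | _ , _ , _ , _ , _ , r = _ , _ , _ , _ , _ , V x>0 r

-- Partitions with size at most 2 wt + 1.

data Tight : List ℕ → ℕ → ℕ → Set where
  isStairs : ∀ a b c → Tight (stairs a b c) (stairsSize a b c) (stairsWt a b c)
  isBumped : ∀ {x y λ′ u v w n N} → Run x (y ∷ λ′) u v w n N → Tight (3 + y ∷ λ′) (3 + n) (1 + N)
  isPadded : ∀ {x λ′ u v w n N} → Run x λ′ u v w n N → Tight (λ′ ++ threeOnes) (3 + n) (1 + N)

head₀≤width : ∀ {x λ′} → All (_≤ x) λ′ → head₀ λ′ ≤ x
head₀≤width all≤ = part-≤ all≤ 0

-- The first hypothesis says that the word does not end in H, which excludes a pending `HHH`; the
-- second excludes `deficient` and `HVV`.
Class⇒Tight : ∀ {x λ′ u v w n N} → x ≤ head₀ λ′ → n < 2 + 2 * N → Class x λ′ u v w n N → Tight λ′ n N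
Class⇒Tight {n = n} {N} _ n< (deficient d) = contradiction n<
  (≤⇒≯ (subst₂ _≤_ (cong (_+ 2 * N) (+-identityʳ 2)) (trans (+-identityʳ (n + 0)) (+-identityʳ n)) (bound₀ d 0)))
Class⇒Tight _ _  (A a refl refl)      = isStairs a 0 0
Class⇒Tight _ _  (A′ a refl refl)     = isStairs a 0 0
Class⇒Tight _ _  (B a b refl refl)    = isStairs a (suc b) 0
Class⇒Tight _ _  (B′ a b refl refl)   = isStairs a b 0
Class⇒Tight _ _  (C a b c refl refl)  = isStairs a b (suc c)
Class⇒Tight _ _  (C′ a b c refl refl) = isStairs a b c
Class⇒Tight _ _  (F a b c refl refl)  = isStairs a b c
Class⇒Tight _ n< HVV                  = contradiction n< (<-irrefl refl)
Class⇒Tight x≤ _ (HHH _ r)            =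
  contradiction (≤-trans x≤ (head₀≤width (Run-parts≤ r))) (<⇒≱ (m≤n+m _ 2))
Class⇒Tight _ _  (HHHV r refl refl)   = isBumped r
Class⇒Tight _ _  (HVVV _ r refl refl) = isPadded r

Run-trim : ∀ {x λ′ u v w n N} → Run x λ′ u v w n N →
           ∃ λ u′ → ∃ λ v′ → ∃ λ w′ → Run (head₀ λ′) λ′ u′ v′ w′ n N
Run-trim start       = _ , _ , _ , start
Run-trim (H r)       = Run-trim r
Run-trim (V x>0 r)   = _ , _ , _ , V x>0 r

Run-tight : ∀ {x λ′ u v w n N} → Run x λ′ u v w n N → n < 2 + 2 * N → Tight λ′ n N
Run-tight r n< with Run-trim r
... | _ , _ , _ , r′ = Class⇒Tight ≤-refl n< (classify r′)

Run-2wt≤size : ∀ {x λ′ u v w n N} → Run x λ′ u v w n N → 2 * N ≤ n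
Run-2wt≤size {n = n} r =
  subst (_ ≤_) (trans (+-identityʳ (n + 0)) (+-identityʳ n)) (bound₀ (Run-bounded r) 0)

-- Trailing H's are dropped and HHH is put before the last V. The three have different classes, so
-- the V gains three boxes, one of them counted.
Run-bump : ∀ {x y λ′ u v w n N} → Run x (y ∷ λ′) u v w n N →
           ∃ λ u′ → ∃ λ v′ → ∃ λ w′ → Run (3 + y) (3 + y ∷ λ′) u′ v′ w′ (3 + n) (1 + N)
Run-bump (H r) = Run-bump r
Run-bump (V {u = u} {v} {w} {n} _ r) =
  _ , _ , _ , Run-subst (lemma u v w n) refl (V (s≤s z≤n) (H (H (H r))))
  where
  lemma : ∀ u v w n → suc u + suc v + suc w + n ≡ 3 + (u + v + w + n)
  lemma = solve-∀

-- The three inserted V's have different classes and are paired with the first H only: three boxes,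
-- one of them counted. Together they shift the height by 3, so no later class changes.
Run-pad : ∀ {x λ′ u v w n N} → 0 < x → Run x λ′ u v w n N →
          Run x (λ′ ++ threeOnes) u v w (3 + n) (1 + N)
Run-pad _   (H start) = H₁VVV
  where
  H₁VVV : Run 1 threeOnes 1 0 0 3 1
  H₁VVV = V (s≤s z≤n) (V (s≤s z≤n) (V (s≤s z≤n) (H start)))
Run-pad _   (H (H r))       = H (Run-pad (s≤s z≤n) (H r))
Run-pad _   (H (V x>0 r))   = H (Run-pad x>0 (V x>0 r))
Run-pad _   (V {u = u} {v} {w} {n} {N} x>0 r) =
  Run-subst (size-lemma u v w n) (+-suc v N) (V x>0 (Run-pad x>0 r))
  where
  size-lemma : ∀ u v w n → u + v + w + (3 + n) ≡ 3 + (u + v + w + n)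
  size-lemma = solve-∀

-- The value of size - 2 wt for staircases.

Balanced : ℕ → ℕ → ℕ → ℕ → Set
Balanced d a b c = a + c ≡ b + d ⊎ b ≡ suc (a + c + d)

balance : ∀ a b c → ∃ λ d → Balanced d a b c
balance a b c with ≤-<-connex b (a + c)
... | inj₁ b≤ = a + c ∸ b , inj₁ (sym (m+[n∸m]≡n b≤))
... | inj₂ <b = b ∸ suc (a + c) , inj₂ (sym (m+[n∸m]≡n <b))

-- As polynomials, size - 2 wt = T (a + c) + T b - b (a + c) - b = T k for k = a + c - b. Since T k
-- = T (-1 - k), the two cases of `Balanced` are k = d and k = -1 - d.
stairsSize-balanced : ∀ {d} a b c → Balanced d a b c → stairsSize a b c ≡ 2 * stairsWt a b c + T d
stairsSize-balanced {d} a b c (inj₁ a+c≡b+d) = begin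
  stairsSize a b c
    ≡⟨ lemma₁ a b c (T a) (T b) (T c) ⟩
  T a + T c + a * c + (a * b + b + T b + b * c + 2 * c)
    ≡⟨ cong (_+ (a * b + b + T b + b * c + 2 * c))
         (trans (sym (T-+ a c)) (trans (cong T a+c≡b+d) (T-+ b d))) ⟩
  T b + T d + b * d + (a * b + b + T b + b * c + 2 * c)
    ≡⟨ lemma₂ a b c d (T b) (T d) ⟩
  T b + T b + (b * d + a * b + b + b * c + 2 * c + T d)
    ≡⟨ cong (_+ (b * d + a * b + b + b * c + 2 * c + T d)) (T+T b) ⟩
  b * b + b + (b * d + a * b + b + b * c + 2 * c + T d)
    ≡⟨ lemma₃ a b c d (T d) ⟩
  b * (b + d) + (a * b + 2 * b + b * c + 2 * c + T d)
    ≡⟨ cong (λ z → b * z + (a * b + 2 * b + b * c + 2 * c + T d)) a+c≡b+d ⟨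
  b * (a + c) + (a * b + 2 * b + b * c + 2 * c + T d)
    ≡⟨ lemma₄ a b c (T d) ⟩
  2 * stairsWt a b c + T d ∎
  where
  open ≡-Reasoning
  lemma₁ : ∀ a b c r s t → r + (suc a * b + s) + ((a + b + 2) * c + t)
                         ≡ r + t + a * c + (a * b + b + s + b * c + 2 * c)
  lemma₁ = solve-∀
  lemma₂ : ∀ a b c d s t → s + t + b * d + (a * b + b + s + b * c + 2 * c)
                         ≡ s + s + (b * d + a * b + b + b * c + 2 * c + t)
  lemma₂ = solve-∀
  lemma₃ : ∀ a b c d t → b * b + b + (b * d + a * b + b + b * c + 2 * c + t)
                       ≡ b * (b + d) + (a * b + 2 * b + b * c + 2 * c + t)
  lemma₃ = solve-∀
  lemma₄ : ∀ a b c t → b * (a + c) + (a * b + 2 * b + b * c + 2 * c + t)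
                     ≡ 2 * (a * b + b * c + b + c) + t
  lemma₄ = solve-∀
stairsSize-balanced {d} a _ c (inj₂ refl) = begin
  stairsSize a b c
    ≡⟨ cong (λ s → T a + (suc a * b + (b + s)) + ((a + b + 2) * c + T c)) (T-+ (a + c) d) ⟩
  T a + (suc a * b + (b + (T (a + c) + T d + (a + c) * d))) + ((a + b + 2) * c + T c)
    ≡⟨ lemma₁ a c d (T a) (T c) (T d) (T (a + c)) ⟩
  T a + T c + a * c + (T (a + c) + (suc a * b + b + (a + c) * d + (b + 2) * c + T d))
    ≡⟨ cong (_+ (T (a + c) + (suc a * b + b + (a + c) * d + (b + 2) * c + T d))) (T-+ a c) ⟨
  T (a + c) + (T (a + c) + (suc a * b + b + (a + c) * d + (b + 2) * c + T d))
    ≡⟨ +-assoc (T (a + c)) _ _ ⟨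
  T (a + c) + T (a + c) + (suc a * b + b + (a + c) * d + (b + 2) * c + T d)
    ≡⟨ cong (_+ (suc a * b + b + (a + c) * d + (b + 2) * c + T d)) (T+T (a + c)) ⟩
  (a + c) * (a + c) + (a + c) + (suc a * b + b + (a + c) * d + (b + 2) * c + T d)
    ≡⟨ lemma₂ a c d (T d) ⟩
  2 * stairsWt a b c + T d ∎
  where
  open ≡-Reasoning
  b = suc (a + c + d)
  lemma₁ : ∀ a c d r t q e → let b = suc (a + c + d) in
    r + (suc a * b + (b + (e + q + (a + c) * d))) + ((a + b + 2) * c + t)
    ≡ r + t + a * c + (e + (suc a * b + b + (a + c) * d + (b + 2) * c + q))
  lemma₁ = solve-∀
  lemma₂ : ∀ a c d q → let b = suc (a + c + d) in
    (a + c) * (a + c) + (a + c) + (suc a * b + b + (a + c) * d + (b + 2) * c + q)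
    ≡ 2 * (a * b + b * c + b + c) + q
  lemma₂ = solve-∀

-- Enumeration of the balanced triples by weight.

Triple : Set
Triple = ℕ × ℕ × ℕ

tripleStairs : Triple → List ℕ
tripleStairs (a , b , c) = stairs a b c

tripleWt : Triple → ℕ
tripleWt (a , b , c) = stairsWt a b c

-- For d ≤ 1 the d-balanced triples form a single chain along which the weight increases by one at each step.
module Chain (Code : Set) (triple : Code → Triple) (origin : Code) (next : Code → Code)
  (wt-origin : tripleWt (triple origin) ≡ 0)
  (wt-next   : ∀ t → tripleWt (triple (next t)) ≡ suc (tripleWt (triple t)))
  (view      : ∀ t → t ≡ origin ⊎ ∃ λ t′ → t ≡ next t′) where

  nth : ℕ → Code
  nth zero    = origin
  nth (suc N) = next (nth N)

  wt-nth : ∀ N → tripleWt (triple (nth N)) ≡ N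
  wt-nth zero    = wt-origin
  wt-nth (suc N) = trans (wt-next (nth N)) (cong suc (wt-nth N))

  -- Every code other than the origin is a successor of weight one less, so descending `wt` steps
  -- ends at the origin.
  nth-unique : ∀ N t → tripleWt (triple t) ≡ N → t ≡ nth N
  nth-unique N t eq with view t
  nth-unique zero    t eq | inj₁ t≡          = t≡
  nth-unique (suc N) t eq | inj₁ refl        = contradiction (trans (sym wt-origin) eq) λ ()
  nth-unique zero    t eq | inj₂ (t′ , refl) = contradiction (trans (sym (wt-next t′)) eq) λ ()
  nth-unique (suc N) t eq | inj₂ (t′ , refl) =
    cong next (nth-unique N t′ (suc-injective (trans (sym (wt-next t′)) eq)))

-- The two constructors are the solutions a + c - b = 0 and a + c - b = -1 of T = 0.
data EvenCode : Set where
  level above : ℕ → ℕ → EvenCode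

evenTriple : EvenCode → Triple
evenTriple (level a c) = a , a + c , c
evenTriple (above a c) = a , suc (a + c) , c

-- The weight is b (a + c) + b + c, so moving a unit from a to c adds one. When a is exhausted, the
-- chain passes to the other constructor with c = 0.
evenNext : EvenCode → EvenCode
evenNext (level zero    c) = above c 0
evenNext (level (suc a) c) = level a (suc c)
evenNext (above zero    c) = level (suc c) 0
evenNext (above (suc a) c) = above a (suc c)

evenWt-next : ∀ t → tripleWt (evenTriple (evenNext t)) ≡ suc (tripleWt (evenTriple t))
evenWt-next (level zero c) = lemma c
  where
  lemma : ∀ c → c * suc (c + 0) + suc (c + 0) * 0 + suc (c + 0) + 0 ≡ suc (0 * c + c * c + c + c)
  lemma = solve-∀
evenWt-next (level (suc a) c) = lemma a c
  where
  lemma : ∀ a c → a * (a + suc c) + (a + suc c) * suc c + (a + suc c) + suc c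
                ≡ suc (suc a * (suc a + c) + (suc a + c) * c + (suc a + c) + c)
  lemma = solve-∀
evenWt-next (above zero c) = lemma c
  where
  lemma : ∀ c → suc c * (suc c + 0) + (suc c + 0) * 0 + (suc c + 0) + 0
              ≡ suc (0 * suc c + suc c * c + suc c + c)
  lemma = solve-∀
evenWt-next (above (suc a) c) = lemma a c
  where
  lemma : ∀ a c → a * suc (a + suc c) + suc (a + suc c) * suc c + suc (a + suc c) + suc c
                ≡ suc (suc a * suc (suc a + c) + suc (suc a + c) * c + suc (suc a + c) + c)
  lemma = solve-∀

evenView : ∀ t → t ≡ level 0 0 ⊎ ∃ λ t′ → t ≡ evenNext t′
evenView (level zero    zero)    = inj₁ refl
evenView (level (suc a) zero)    = inj₂ (above 0 a , refl)
evenView (level a       (suc c)) = inj₂ (level (suc a) c , refl)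
evenView (above a       zero)    = inj₂ (level 0 a , refl)
evenView (above a       (suc c)) = inj₂ (above (suc a) c , refl)

-- Here T = 1, so a + c - b is 1 or -2. The first case is split by whether a is positive, because b
-- = a + c - 1 would need a subtraction.
data OddCode : Set where
  below₊ : ℕ → ℕ → OddCode
  below₀ : ℕ → OddCode
  above  : ℕ → ℕ → OddCode

oddTriple : OddCode → Triple
oddTriple (below₊ a c) = suc a , a + c , c
oddTriple (below₀ c)   = 0 , c , suc c
oddTriple (above a c)  = a , suc (suc (a + c)) , c

oddNext : OddCode → OddCode
oddNext (below₊ zero    c) = below₀ c
oddNext (below₊ (suc a) c) = below₊ a (suc c)
oddNext (below₀ c)         = above c 0
oddNext (above zero     c) = below₊ (suc c) 0
oddNext (above (suc a)  c) = above a (suc c)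

oddWt-next : ∀ t → tripleWt (oddTriple (oddNext t)) ≡ suc (tripleWt (oddTriple t))
oddWt-next (below₊ zero c) = lemma c
  where
  lemma : ∀ c → 0 * c + c * suc c + c + suc c ≡ suc (1 * c + c * c + c + c)
  lemma = solve-∀
oddWt-next (below₊ (suc a) c) = lemma a c
  where
  lemma : ∀ a c → suc a * (a + suc c) + (a + suc c) * suc c + (a + suc c) + suc c
                ≡ suc (suc (suc a) * (suc a + c) + (suc a + c) * c + (suc a + c) + c)
  lemma = solve-∀
oddWt-next (below₀ c) = lemma c
  where
  lemma : ∀ c → c * suc (suc (c + 0)) + suc (suc (c + 0)) * 0 + suc (suc (c + 0)) + 0
              ≡ suc (0 * c + c * suc c + c + suc c)
  lemma = solve-∀
oddWt-next (above zero c) = lemma c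
  where
  lemma : ∀ c → suc (suc c) * (suc c + 0) + (suc c + 0) * 0 + (suc c + 0) + 0
              ≡ suc (0 * suc (suc c) + suc (suc c) * c + suc (suc c) + c)
  lemma = solve-∀
oddWt-next (above (suc a) c) = lemma a c
  where
  lemma : ∀ a c → a * suc (suc (a + suc c)) + suc (suc (a + suc c)) * suc c + suc (suc (a + suc c)) + suc c
                ≡ suc (suc a * suc (suc (suc a + c)) + suc (suc (suc a + c)) * c + suc (suc (suc a + c)) + c)
  lemma = solve-∀

oddView : ∀ t → t ≡ below₊ 0 0 ⊎ ∃ λ t′ → t ≡ oddNext t′
oddView (below₊ zero    zero)    = inj₁ refl
oddView (below₊ (suc a) zero)    = inj₂ (above 0 a , refl)
oddView (below₊ a       (suc c)) = inj₂ (below₊ (suc a) c , refl)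
oddView (below₀ c)               = inj₂ (below₊ 0 c , refl)
oddView (above a        zero)    = inj₂ (below₀ a , refl)
oddView (above a        (suc c)) = inj₂ (above (suc a) c , refl)

module Even = Chain EvenCode evenTriple (level 0 0) evenNext refl evenWt-next evenView
module Odd  = Chain OddCode oddTriple (below₊ 0 0) oddNext refl oddWt-next oddView

evenStairs oddStairs : ℕ → List ℕ
evenStairs N = tripleStairs (evenTriple (Even.nth N))
oddStairs  N = tripleStairs (oddTriple (Odd.nth N))

stairs-even : ∀ a b c → Balanced 0 a b c → stairs a b c ≡ evenStairs (stairsWt a b c)
stairs-even a b c (inj₁ eq) with trans eq (+-identityʳ b)
... | refl = cong (tripleStairs ∘ evenTriple) (Even.nth-unique _ (level a c) refl)
stairs-even a b c (inj₂ eq) with trans eq (cong suc (+-identityʳ (a + c)))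
... | refl = cong (tripleStairs ∘ evenTriple) (Even.nth-unique _ (above a c) refl)

stairs-odd : ∀ a b c → Balanced 1 a b c → stairs a b c ≡ oddStairs (stairsWt a b c)
stairs-odd zero b c (inj₁ eq) with trans eq (+-comm b 1)
... | refl = cong (tripleStairs ∘ oddTriple) (Odd.nth-unique _ (below₀ b) refl)
stairs-odd (suc a) b c (inj₁ eq) with suc-injective (trans eq (+-comm b 1))
... | refl = cong (tripleStairs ∘ oddTriple) (Odd.nth-unique _ (below₊ a c) refl)
stairs-odd a b c (inj₂ eq) with trans eq (cong suc (+-comm (a + c) 1))
... | refl = cong (tripleStairs ∘ oddTriple) (Odd.nth-unique _ (above a c) refl)

T≡0⇒≡0 : ∀ d → T d ≡ 0 → d ≡ 0
T≡0⇒≡0 zero _ = refl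

T≡1⇒≡1 : ∀ d → T d ≡ 1 → d ≡ 1
T≡1⇒≡1 (suc zero) _ = refl
T≡1⇒≡1 (suc (suc d)) ()

-- Determination of the partitions with size - 2 wt equal to 0 or 1.

bump : List ℕ → List ℕ
bump []       = []
bump (y ∷ λ′) = 3 + y ∷ λ′

-- Taking out HHH or VVV lowers size - 2 wt by one: from 0 this is impossible, and from 1 it leaves
-- a partition already determined.
size-rest : ∀ k n N → 3 + n ≡ 2 * (1 + N) + k → suc n ≡ 2 * N + k
size-rest k n N eq = suc-injective (suc-injective (trans eq (cong (_+ k) (*-suc 2 N))))

Tight-even : ∀ {λ′ n N} → Tight λ′ n N → n ≡ 2 * N + 0 → λ′ ≡ evenStairs N
Tight-even (isStairs a b c) eq with balance a b c
... | d , bal with T≡0⇒≡0 d (+-cancelˡ-≡ _ _ _ (trans (sym (stairsSize-balanced a b c bal)) eq))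
... | refl = stairs-even a b c bal
Tight-even (isBumped {n = n} {N} r) eq =
  contradiction (Run-2wt≤size r) (<⇒≱ (≤-reflexive (trans (size-rest 0 n N eq) (+-identityʳ _))))
Tight-even (isPadded {n = n} {N} r) eq =
  contradiction (Run-2wt≤size r) (<⇒≱ (≤-reflexive (trans (size-rest 0 n N eq) (+-identityʳ _))))

Run-even : ∀ {x λ′ u v w n N} → Run x λ′ u v w n N → n ≡ 2 * N + 0 → λ′ ≡ evenStairs N
Run-even {N = N} r eq =
  Tight-even (Run-tight r (≤-trans (≤-reflexive (cong suc (trans eq (+-identityʳ (2 * N))))) (n≤1+n _))) eq

Run-odd-rest : ∀ {x λ′ u v w n N} → Run x λ′ u v w n N → 3 + n ≡ 2 * (1 + N) + 1 → λ′ ≡ evenStairs N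
Run-odd-rest {n = n} {N} r eq = Run-even r (suc-injective (trans (size-rest 1 n N eq) (+-suc (2 * N) 0)))

Tight-odd : ∀ {λ′ n N M} → Tight λ′ n N → N ≡ suc M → n ≡ 2 * N + 1 →
  λ′ ≡ oddStairs (suc M) ⊎ λ′ ≡ bump (evenStairs M) ⊎ λ′ ≡ evenStairs M ++ threeOnes
Tight-odd (isStairs a b c) N≡ eq with balance a b c
... | d , bal with T≡1⇒≡1 d (+-cancelˡ-≡ _ _ _ (trans (sym (stairsSize-balanced a b c bal)) eq))
... | refl = inj₁ (trans (stairs-odd a b c bal) (cong oddStairs N≡))
Tight-odd (isBumped r) refl eq = inj₂ (inj₁ (cong bump (Run-odd-rest r eq)))
Tight-odd (isPadded r) refl eq = inj₂ (inj₂ (cong (_++ threeOnes) (Run-odd-rest r eq)))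

-- The listed partitions have the required size and weight.

Satisfies : ℕ → ℕ → List ℕ → Set
Satisfies k n λ′ = IsPartitionOf n λ′ × wtZ3 λ′ ≡ k

Run⇒Satisfies : ∀ {x λ′ u v w n N} → Run x λ′ u v w n N → Satisfies N n λ′
Run⇒Satisfies r = (Run-IsPartition r , Run-size r) , Run-wt r

Satisfies⇒Run : ∀ {k n λ′} → Satisfies k n λ′ → ∃ λ u → ∃ λ v → ∃ λ w → Run (head₀ λ′) λ′ u v w n k
Satisfies⇒Run {λ′ = λ′} ((isP , refl) , refl) with IsPartition⇒Reachable λ′ isP
... | _ , _ , _ , _ , _ , r = _ , _ , _ , Run-subst (sym (Run-size r)) (sym (Run-wt r)) r

-- `Run-pad` needs a positive width. Even the empty partition gets one, from the trailing H's of
-- `Run-C`.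
record Realized (λ′ : List ℕ) (n N : ℕ) : Set where
  constructor realized
  field
    {x u v w} : ℕ
    width>0   : 0 < x
    run       : Run x λ′ u v w n N

evenStairs-realized : ∀ N → Realized (evenStairs N) (2 * N) N
evenStairs-realized N with Even.nth N | Even.wt-nth N
... | level a c | refl = realized (positive c) (Run-subst
        (trans (stairsSize-balanced a (a + c) c (inj₁ (sym (+-identityʳ _)))) (+-identityʳ _)) refl (Run-C a (a + c) c))
... | above a c | refl = realized (positive c) (Run-subst
        (trans (stairsSize-balanced a (suc (a + c)) c (inj₂ (cong suc (sym (+-identityʳ _))))) (+-identityʳ _)) refl
        (Run-C a (suc (a + c)) c))

oddStairs-realized : ∀ N → Realized (oddStairs N) (2 * N + 1) N
oddStairs-realized N with Odd.nth N | Odd.wt-nth N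
... | below₊ a c | refl = realized (positive c) (Run-subst
        (stairsSize-balanced (suc a) (a + c) c (inj₁ (sym (+-comm (a + c) 1)))) refl (Run-C (suc a) (a + c) c))
... | below₀ c | refl = realized (positive (suc c)) (Run-subst
        (stairsSize-balanced 0 c (suc c) (inj₁ (sym (+-comm c 1)))) refl (Run-C 0 c (suc c)))
... | above a c | refl = realized (positive c) (Run-subst
        (stairsSize-balanced a (suc (suc (a + c))) c (inj₂ (cong suc (sym (+-comm (a + c) 1))))) refl
        (Run-C a (suc (suc (a + c))) c))

3+even : ∀ M → 3 + 2 * M ≡ 2 * suc M + 1
3+even = solve-∀

bump-satisfies : ∀ M → Satisfies (2 + M) (2 * (2 + M) + 1) (bump (evenStairs (suc M)))
bump-satisfies M with evenStairs (suc M) | evenStairs-realized (suc M)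
-- The weight `suc M` is positive, so there is a row to lengthen.
... | []    | realized _ r = contradiction (Run-wt r) λ ()
... | _ ∷ _ | realized _ r with Run-bump r
... | _ , _ , _ , r′ = Run⇒Satisfies (Run-subst (3+even (suc M)) refl r′)

padded-satisfies : ∀ M → Satisfies (suc M) (2 * suc M + 1) (evenStairs M ++ threeOnes)
padded-satisfies M with evenStairs-realized M
... | realized x>0 r = Run⇒Satisfies (Run-subst (3+even M) refl (Run-pad x>0 r))

-- Distinctness of the three partitions.

Linked-∷ : ∀ {x λ′} → head₀ λ′ < x → Linked _>_ λ′ → Linked _>_ (x ∷ λ′)
Linked-∷ h<x []      = [-]
Linked-∷ h<x [-]     = h<x ∷ [-]
Linked-∷ h<x (p ∷ l) = h<x ∷ p ∷ l

ladder-head≤ : ∀ k {x λ′} → head₀ λ′ ≤ x → head₀ (ladder k x λ′) ≤ k + x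
ladder-head≤ zero    h≤x = h≤x
ladder-head≤ (suc k) h≤x = ≤-refl

ladder-strict : ∀ k {x λ′} → head₀ λ′ ≤ x → Linked _>_ λ′ → Linked _>_ (ladder k x λ′)
ladder-strict zero    h≤x l = l
ladder-strict (suc k) h≤x l = Linked-∷ (s≤s (ladder-head≤ k h≤x)) (ladder-strict k h≤x l)

stairs-strict : ∀ a b c → Linked _>_ (stairs a b c)
stairs-strict a b c = ladder-strict c h₂ (ladder-strict b h₁ (ladder-strict a z≤n []))
  where
  h₁ = m≤n⇒m≤1+n (ladder-head≤ a {0} {[]} z≤n)
  h₂ = m≤n⇒m≤1+n (ladder-head≤ b h₁)

tripleStairs-strict : ∀ t → Linked _>_ (tripleStairs t)
tripleStairs-strict (a , b , c) = stairs-strict a b c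

bump-strict : ∀ {λ′} → Linked _>_ λ′ → Linked _>_ (bump λ′)
bump-strict []      = []
bump-strict [-]     = [-]
bump-strict (p ∷ l) = <-≤-trans p (m≤n+m _ 3) ∷ l

padded-not-strict : ∀ λ′ {μ} → Linked _>_ μ → μ ≢ λ′ ++ threeOnes
padded-not-strict []       (1>1 ∷ _) refl = contradiction 1>1 (<-irrefl refl)
padded-not-strict (x ∷ λ′) l         refl = padded-not-strict λ′ (Linked.tail l) refl

ladder-head≥ : ∀ k {x λ′} → x ≤ suc (head₀ λ′) → k + x ≤ suc (head₀ (ladder k x λ′))
ladder-head≥ zero    x≤ = x≤
ladder-head≥ (suc k) x≤ = n≤1+n _

-- With a positive middle block the two extra H's are not separated by H alone, so at most two H's
-- stand before the last V since the previous one.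
stairs-gap : ∀ a b c → head₀ (stairs a (suc b) c) ≤ 2 + part (stairs a (suc b) c) 1
stairs-gap a b zero    = s≤s (ladder-head≥ b (s≤s (ladder-base a)))
  where
  ladder-base : ∀ a → a + 0 ≤ head₀ (ladder a 0 [])
  ladder-base zero    = z≤n
  ladder-base (suc a) = ≤-refl
stairs-gap a b (suc c) = s≤s (ladder-head≥ c ≤-refl)

stairs≢bump : ∀ a b c {λ′} → IsPartition λ′ → stairs a (suc b) c ≢ bump λ′
stairs≢bump a b zero    {[]} _ ()
stairs≢bump a b (suc c) {[]} _ ()
stairs≢bump a b c {y ∷ λ′} (linked , _) eq =
  contradiction (subst (λ μ → head₀ μ ≤ 2 + part μ 1) eq (stairs-gap a b c))
                (<⇒≱ (s≤s (s≤s (s≤s (head₀-≤ linked)))))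

-- A weight of at least 2 rules out the codes with empty middle block, `below₊ 0 0` and `below₀ 0`,
-- of weights 0 and 1. In all others the first two parts differ by at most 2, whereas after `bump`
-- they differ by at least 3.
oddStairs≢bump : ∀ M {λ′} → IsPartition λ′ → oddStairs (2 + M) ≢ bump λ′
oddStairs≢bump M isP with Odd.nth (2 + M) | Odd.wt-nth (2 + M)
... | below₊ zero    (suc c) | _ = stairs≢bump 1 c (suc c) isP
... | below₊ (suc a) c       | _ = stairs≢bump (2 + a) (a + c) c isP
... | below₀ (suc c)         | _ = stairs≢bump 0 c (2 + c) isP
... | above a c              | _ = stairs≢bump a (suc (a + c)) c isP

-- The three counts.

evenCount : ∀ n → btilde≡ n (2 * n) 1
evenCount n = evenStairs n ∷ [] , refl , [] ∷ [] , complete , sound ∷ []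
  where
  complete : ∀ λ′ → Satisfies n (2 * n) λ′ → λ′ ∈ evenStairs n ∷ []
  complete λ′ s with Satisfies⇒Run s
  ... | _ , _ , _ , r = here (Run-even r (sym (+-identityʳ _)))
  sound : Satisfies n (2 * n) (evenStairs n)
  sound = Run⇒Satisfies (Realized.run (evenStairs-realized n))

oddCount : ∀ M → let n = 2 + M in btilde≡ n (2 * n + 1) 3
oddCount M =
  oddStairs n ∷ bump E ∷ (E ++ threeOnes) ∷ [] , refl ,
  (oddStairs≢bump M E-partition ∷ padded-not-strict E (tripleStairs-strict (oddTriple (Odd.nth n))) ∷ []) ∷
    (padded-not-strict E (bump-strict (tripleStairs-strict (evenTriple (Even.nth (suc M))))) ∷ []) ∷ [] ∷ [] ,
  complete ,
  Run⇒Satisfies (Realized.run (oddStairs-realized n)) ∷ bump-satisfies M ∷ padded-satisfies (suc M) ∷ []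
  where
  n = 2 + M
  E = evenStairs (suc M)
  E-partition : IsPartition E
  E-partition = Run-IsPartition (Realized.run (evenStairs-realized (suc M)))
  complete : ∀ λ′ → Satisfies n (2 * n + 1) λ′ → λ′ ∈ oddStairs n ∷ bump E ∷ (E ++ threeOnes) ∷ []
  complete λ′ s with Satisfies⇒Run s
  ... | _ , _ , _ , r with Tight-odd (Run-tight r (≤-reflexive (cong suc (+-comm (2 * n) 1)))) refl refl
  ... | inj₁ eq        = here eq
  ... | inj₂ (inj₁ eq) = there (here eq)
  ... | inj₂ (inj₂ eq) = there (there (here eq))

zeroCount : ∀ k n → n < 2 * k → btilde≡ k n 0
zeroCount k n n<2k = [] , refl , [] , complete , []
  where
  complete : ∀ λ′ → Satisfies k n λ′ → λ′ ∈ []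
  complete λ′ s with Satisfies⇒Run s
  ... | _ , _ , _ , r = contradiction (Run-2wt≤size r) (<⇒≱ n<2k)

theorem1p6 : ((n : ℕ) → 2 ≤ n → btilde≡ n (2 * n) 1 × btilde≡ n (2 * n + 1) 3)
    × ((k n : ℕ) → n < 2 * k → btilde≡ k n 0)
theorem1p6 = (λ { (suc (suc M)) (s≤s (s≤s _)) → evenCount (2 + M) , oddCount M }) , zeroCount
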